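{- Fix a polynomial $p$. Consider DAG Utility Maximization problems in the MPOI world with ground set $J$, $n=|J|$, downward-closed constraints $\mathcal{F}$ with $k=\max_{I\in\mathcal{F}}|I|$, semiadditive objective $f(I,x)=\sum_{i\in I}x_i+h(I)$, and DAG Markov systems $(S_i)_{i\in J}$ of maximum depth $D$, such that all prices and values have absolute value at most $B\le p(n,k,D)$. Suppose there is an $\alpha$-approximation frugal packing algorithm for $(J,\mathcal{F},f)$ in the free-information world. Then there is a polynomial $q$ in $n,k,D$ such that for every $\epsilon>0$ the following holds: if every input parameter (transition probability, price, value) of the Markov systems is known to within an additive error of $\epsilon/q(n,k,D)$, then there exists an adaptive strategy, constructed from these estimates, whose utility (in the true instance) is at least $\frac{1}{\alpha}\cdot\mathrm{OPT}-\epsilon$, where $\mathrm{OPT}$ is the utility of the optimal strategy that knows the true parameters exactly.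
   Context: A Markov system $S=(V,P,s,T,\pi,r)$ consists of a Markov chain on a finite state space $V$ with transition matrix $P$, a starting state $s$, a set $T\subseteq V$ of absorbing destination states, prices $\pi^u\ge0$ for $u\in V\setminus T$, and values $r^t$ for $t\in T$; every state reaches some destination state. It is a DAG Markov system if the directed graph with an arc $u\to v$ whenever $u\notin T$ and $p_{u,v}>0$ is acyclic; its depth is the maximum number of transitions on a path from $s$. MPOI game / Utility Maximization: each $S_i$ starts at $s_i$; at each step the player either advances some $S_i$ from its current non-destination state $u$, paying $\pi_i^u$ (the state then moves randomly according to $P_i$), or ends the game by selecting a set $I\in\mathcal{F}$ of ready elements (elements whose Markov system is in a destination state). $\mathcal{F}$ is downward-closed and all values are non-negative. The utility of an adaptive strategy is $\mathbb{E}[f(I,(r_i^{\mathrm{dest}(\sigma_i)})_{i\in I})-\text{total price paid}]$, where $\mathrm{dest}(\sigma_i)$ is the destination reached by $S_i$. The estimates form Markov systems on the same state spaces with the same starting and destination states. Free-information world: for value vector $y\in\mathbb{R}^J$, choose $I\in\mathcal{F}$ maximizing $f(I,y)$; an $\alpha$-approximation ($\alpha\ge1$) returns $I\in\mathcal{F}$ with $f(I,y)\ge\frac1\alpha\max_{I'\in\mathcal{F}}f(I',y)$ for every $y$. Frugal packing algorithm: there is a marginal-value function $g(Y,i,y)$, increasing in $y$, such that on input $y$ the algorithm starts with $M=\emptyset$, repeatedly computes $v_i=g((y_j)_{j\in M},i,y_i)$ for $i\notin M$, takes $j=\arg\max\{v_i:i\notin M,\ M\cup\{i\}\in\mathcal{F}\}$,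 adds $j$ if $v_j>0$ and repeats, otherwise returns $M$.
   Formalization: Transition probabilities must be known within ε/q for every set of target states (total variation), not just entrywise, since the entrywise claim fails when the state spaces are unbounded; numbers lie in any ordered field with decidable order, and membership in F is decidable. -}

module Defs where

open import Algebra.Bundles using (CommutativeRing)
open import Algebra.Structures using (IsCommutativeRing)
import Algebra.Properties.CommutativeMonoid.Sum as Sum
open import Data.Bool using (if_then_else_)
open import Data.Fin using (Fin; _≟_)
open import Data.Fin.Subset using (Subset; _∈_; _∉_; _⊆_; _∪_; ⁅_⁆; ∣_∣) renaming (⊥ to ∅)
open import Data.Maybe using (Maybe; just; nothing)
open import Data.Nat as ℕ using (ℕ; zero; suc)
open import Data.Product using (Σ; ∃; ∃₂; _×_; _,_)
open import Data.Sum using (_⊎_)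
open import Data.Vec using (Vec; lookup; tabulate)
open import Data.Vec.Functional using (foldr)
open import Level using (0ℓ)
open import Function.Definitions using (Injective)
open import Relation.Binary using (Rel; IsDecTotalOrder)
open import Relation.Binary.PropositionalEquality using (_≡_; _≢_; refl)
open import Relation.Nullary using (¬_; does; yes; no)
open import Relation.Unary using (Pred; Decidable)

-- Linearly ordered fields.  Classically ℝ is one, and so is ℚ.  The value
-- of 0# ⁻¹ is unspecified.
record OrderedField : Set₁ where
  infix  8 _⁻¹ -_
  infixl 7 _*_
  infixl 6 _+_ _-_
  infix  4 _≤_ _<_
  field
    Carrier           : Set
    _≤_               : Rel Carrier 0ℓ
    _+_ _*_           : Carrier → Carrier → Carrier
    -_ _⁻¹            : Carrier → Carrier
    0# 1#             : Carrier
    isCommutativeRing : IsCommutativeRing _≡_ _+_ _*_ -_ 0# 1#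
    isDecTotalOrder   : IsDecTotalOrder _≡_ _≤_
    0≢1               : 0# ≢ 1#
    *-inverseʳ        : ∀ {x} → x ≢ 0# → x * x ⁻¹ ≡ 1#
    +-monoˡ-≤         : ∀ z {x y} → x ≤ y → x + z ≤ y + z
    *-nonneg          : ∀ {x y} → 0# ≤ x → 0# ≤ y → 0# ≤ x * y

  open IsDecTotalOrder isDecTotalOrder public using (_≤?_)

  commutativeRing : CommutativeRing 0ℓ 0ℓ
  commutativeRing = record { isCommutativeRing = isCommutativeRing }

  _<_ : Rel Carrier 0ℓ
  x < y = x ≤ y × x ≢ y

  _-_ : Carrier → Carrier → Carrier
  x - y = x + - y

  abs : Carrier → Carrier
  abs x = if does (0# ≤? x) then x else - x

  fromℕ : ℕ → Carrier
  fromℕ zero    = 0#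
  fromℕ (suc n) = 1# + fromℕ n

  open Sum (CommutativeRing.+-commutativeMonoid commutativeRing) public using (sum)

  sumOver : ∀ {n} → Subset n → (Fin n → Carrier) → Carrier
  sumOver I x = sum (λ i → if lookup I i then x i else 0#)

module MPOI (K : OrderedField) where
  open OrderedField K public renaming (Carrier to R)

  infixl 6 _⊕_
  infixl 7 _⊗_

  data Polynomial : Set where
    con         : R → Polynomial
    𝐧 𝐤 𝐃       : Polynomial
    _⊕_ _⊗_     : Polynomial → Polynomial → Polynomial

  ⟦_⟧ : Polynomial → ℕ → ℕ → ℕ → R
  ⟦ con c ⟧ n k D = c
  ⟦ 𝐧 ⟧     n k D = fromℕ n
  ⟦ 𝐤 ⟧     n k D = fromℕ k
  ⟦ 𝐃 ⟧     n k D = fromℕ D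
  ⟦ p ⊕ q ⟧ n k D = ⟦ p ⟧ n k D + ⟦ q ⟧ n k D
  ⟦ p ⊗ q ⟧ n k D = ⟦ p ⟧ n k D * ⟦ q ⟧ n k D

  -- The ground set J is Fin n.
  record Packing (n k : ℕ) : Set₁ where
    field
      𝓕            : Pred (Subset n) 0ℓ
      𝓕?           : Decidable 𝓕
      downClosed   : ∀ {I I′} → I′ ⊆ I → 𝓕 I → 𝓕 I′
      rankAttained : ∃ λ I → 𝓕 I × ∣ I ∣ ≡ k
      rankBound    : ∀ I → 𝓕 I → ∣ I ∣ ℕ.≤ k
      h            : Subset n → R

    f : Subset n → (Fin n → R) → R
    f I x = sumOver I x + h I

  -- The partial vector (y_j)_{j ∈ M}; it determines M.
  restrict : ∀ {n} → Subset n → (Fin n → R) → Vec (Maybe R) n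
  restrict M y = tabulate (λ j → if lookup M j then just (y j) else nothing)

  -- Ties in the arg max go to the element of least priority number.  The
  -- priorities are an arbitrary linear order on J, but one that does not
  -- depend on y: a tie-breaking rule that inspects all of y could simulate
  -- any algorithm whatsoever (take g constant).
  record FrugalAlgorithm (n : ℕ) : Set where
    field
      g                 : Vec (Maybe R) n → Fin n → R → R
      g-mono            : ∀ Y i {y y′} → y ≤ y′ → g Y i y ≤ g Y i y′
      priority          : Fin n → ℕ
      priorityInjective : Injective _≡_ _≡_ priority

  module _ {n k : ℕ} (Q : Packing n k) (A : FrugalAlgorithm n) (y : Fin n → R) where
    open Packing Q
    open FrugalAlgorithm A

    marginal : Subset n → Fin n → R
    marginal M i = g (restrict M y) i (y i)

    Candidate : Subset n → Fin n → Set
    Candidate M i = i ∉ M × 𝓕 (M ∪ ⁅ i ⁆)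

    IsArgMax : Subset n → Fin n → Set
    IsArgMax M j = Candidate M j × (∀ i → Candidate M i →
      marginal M i < marginal M j
        ⊎ (marginal M i ≡ marginal M j × priority j ℕ.≤ priority i))

    -- Returns M I : started from the partial solution M, the algorithm returns I.
    data Returns (M : Subset n) : Subset n → Set where
      stop : (∀ j → IsArgMax M j → ¬ (0# < marginal M j)) → Returns M M
      add  : ∀ {j I} → IsArgMax M j → 0# < marginal M j →
             Returns (M ∪ ⁅ j ⁆) I → Returns M I

  IsApproximation : ∀ {n k} → Packing n k → R → FrugalAlgorithm n → Set
  IsApproximation Q α A =
    ∀ y I → Returns Q A y ∅ I → 𝓕 I × (∀ I′ → 𝓕 I′ → α ⁻¹ * f I′ y ≤ f I y)
    where open Packing Q

  data Path {m : ℕ} (T : Subset m) (P : Fin m → Fin m → R) : ℕ → Rel (Fin m) 0ℓ where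
    []  : ∀ {u} → Path T P 0 u u
    _∷_ : ∀ {u v w ℓ} → u ∉ T × 0# < P u v → Path T P ℓ v w → Path T P (suc ℓ) u w

  -- The prices of destination states and the values of the other states are
  -- junk: nothing below refers to them.
  record MarkovSystem {m : ℕ} (s : Fin m) (T : Subset m) : Set where
    field
      P           : Fin m → Fin m → R
      π           : Fin m → R
      r           : Fin m → R
      P-nonneg    : ∀ u v → 0# ≤ P u v
      P-sum       : ∀ u → sum (P u) ≡ 1#
      P-absorbing : ∀ {t} → t ∈ T → P t t ≡ 1#
      π-nonneg    : ∀ {u} → u ∉ T → 0# ≤ π u
      reaches     : ∀ u → ∃₂ λ t ℓ → t ∈ T × Path T P ℓ u t

  module _ {m : ℕ} {s : Fin m} {T : Subset m} (S : MarkovSystem s T) where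
    open MarkovSystem S

    IsDAG : Set
    IsDAG = ∀ u ℓ → ¬ Path T P (suc ℓ) u u

    IsDepth : ℕ → Set
    IsDepth d = ∃ (λ v → Path T P d s v) × (∀ v ℓ → Path T P ℓ s v → ℓ ℕ.≤ d)

    NonNegativeValues : Set
    NonNegativeValues = ∀ t → t ∈ T → 0# ≤ r t

    BoundedBy : R → Set
    BoundedBy B = (∀ u → u ∉ T → abs (π u) ≤ B) × (∀ t → t ∈ T → abs (r t) ≤ B)

  -- A transition probability out of u is P(u, A), the probability of moving
  -- from u into A, for any A ⊆ V.  Accuracy on singletons A alone could not
  -- suffice, as |V| is not bounded in terms of n, k and D.  Let n = k = D = 1
  -- and h = 0, let s have price 1/2, and let N destinations have value 1 and
  -- N have value 0.  The estimate "uniform on all 2N" has entries within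
  -- 1/(2N) of both "uniform on value 1" (where advancing yields OPT = 1/2) and
  -- "uniform on value 0" (where advancing yields -1/2 and OPT = 0), so a
  -- strategy depending only on the estimate fails for one of the two.
  record Close {m : ℕ} {s : Fin m} {T : Subset m} (δ : R) (Ŝ S : MarkovSystem s T) : Set where
    private
      module Ŝ = MarkovSystem Ŝ
      module S = MarkovSystem S
    field
      P-close : ∀ u → u ∉ T → ∀ A → abs (sumOver A (Ŝ.P u) - sumOver A (S.P u)) ≤ δ
      π-close : ∀ u → u ∉ T → abs (Ŝ.π u - S.π u) ≤ δ
      r-close : ∀ t → t ∈ T → abs (Ŝ.r t - S.r t) ≤ δ

  _[_≔_] : ∀ {n} {m : Fin n → ℕ} → (∀ i → Fin (m i)) → (i : Fin n) → Fin (m i) → ∀ j → Fin (m j)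
  (σ [ i ≔ v ]) j with i ≟ j
  ... | yes refl = v
  ... | no _     = σ j

  module _ {n : ℕ} {m : Fin n → ℕ} {s : ∀ i → Fin (m i)} {T : ∀ i → Subset (m i)} where

    HasMaxDepth : (∀ i → MarkovSystem (s i) (T i)) → ℕ → Set
    HasMaxDepth S D = Σ (Fin n → ℕ) λ d → (∀ i → IsDepth (S i) (d i)) × D ≡ foldr ℕ._⊔_ 0 d

  module _ {n k : ℕ} (Q : Packing n k) {m : Fin n → ℕ} (T : ∀ i → Subset (m i)) where
    open Packing Q

    -- Adaptive strategies, as decision trees, for playing on from joint state
    -- σ.  They mention no prices, values or transition probabilities.
    data Strategy (σ : ∀ i → Fin (m i)) : Set where
      select  : ∀ I → 𝓕 I → (∀ i → i ∈ I → σ i ∈ T i) → Strategy σ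
      advance : ∀ i → σ i ∉ T i → (∀ v → Strategy (σ [ i ≔ v ])) → Strategy σ

  module _ {n k : ℕ} (Q : Packing n k) {m : Fin n → ℕ} {s : ∀ i → Fin (m i)}
           {T : ∀ i → Subset (m i)} (S : ∀ i → MarkovSystem (s i) (T i)) where
    open Packing Q
    private module S i = MarkovSystem (S i)

    -- The expectation of f − total price when the amount c has already been paid.
    expectation : ∀ {σ} → R → Strategy Q T σ → R
    expectation {σ} c (select I _ _)    = f I (λ i → S.r i (σ i)) - c
    expectation {σ} c (advance i _ next) =
      sum (λ v → S.P i (σ i) v * expectation (c + S.π i (σ i)) (next v))

    utility : Strategy Q T s → R
    utility = expectation 0#

    IsOPT : R → Set
    IsOPT OPT = ∃ (λ τ → utility τ ≡ OPT) × (∀ τ → utility τ ≤ OPT)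

{-# OPTIONS --safe #-}
-- The strategy is backward induction on the estimates with horizon n D, and it
-- is within ε of OPT itself.  This implies the bound with α⁻¹ OPT, because
-- α⁻¹ OPT ≤ OPT: an α-approximation with α > 1 must return ∅, with nonnegative
-- objective, when all values are very negative, so h ∅ ≥ 0 and hence OPT ≥ 0.
--
-- The difficulty is that h is unbounded, so an error δ in a transition
-- probability could be multiplied by a large value.  But let H be the maximum
-- of h on 𝓕.  Finishing every system and then selecting a maximizer of h yields
-- at least H - n D B, while nothing yields more than H + n B.  Values to go
-- therefore vary by at most (n + n D) B, and an error of δ in the parameters
-- changes them by only O((1 + (n + n D) B) δ) per step.
module Submission where

open import Defs
open import Algebra.Bundles using (CommutativeRing)
import Algebra.Construct.NaturalChoice.Min as Min
import Algebra.Properties.AbelianGroup as AbelianGroupProperties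
import Algebra.Properties.CommutativeMonoid.Sum as Sum
import Algebra.Properties.Semiring.Sum as SemiringSum
import Algebra.Solver.Ring.NaturalCoefficients.Default as Solver
open import Data.Bool using (true; false; if_then_else_)
open import Data.Bool.Properties using (if-eta)
open import Data.Fin using (Fin; zero; suc; _≟_)
open import Data.Fin.Properties using (any?; all?)
open import Data.Fin.Subset using (Subset; Nonempty; _∈_; _∉_; _⊃_; _∪_; ⁅_⁆) renaming (⊥ to ∅)
open import Data.Fin.Subset.Induction using (⊃-wellFounded)
open import Data.Fin.Subset.Properties using (_∈?_; ∉⊥; ⊥⊆; nonempty?; Empty-unique; p⊆p∪q; q⊆p∪q; x∈⁅x⁆)
open import Data.List using (List; []; _∷_; [_]; _++_; map; concatMap; filter; allFin)
import Data.List.Extrema as Extrema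
import Data.List.Membership.Propositional as List
open import Data.List.Membership.Propositional.Properties using (∈-map⁺; ∈-++⁺ˡ; ∈-++⁺ʳ; ∈-filter⁺; ∈-allFin)
open import Data.List.Relation.Unary.All as All using (All; []; _∷_)
import Data.List.Relation.Unary.All.Properties as All
open import Data.List.Relation.Unary.Any as Any using (Any; here)
import Data.List.Relation.Unary.Any.Properties as Any
open import Data.Nat as ℕ using (ℕ; zero; suc)
import Data.Nat.Properties as ℕ
open import Data.Product using (Σ; ∃; _×_; _,_; proj₁; proj₂)
open import Data.Sum using (_⊎_; inj₁; inj₂)
import Data.Vec as Vec
import Data.Vec.Functional as Vector
open import Data.Vec.Functional.Properties using (updateAt-updates; updateAt-minimal)
open import Data.Vec.Properties using (lookup∘tabulate; lookup⇒[]=)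
open import Function using (_∘_)
open import Induction.WellFounded using (Acc; acc)
open import Level using (0ℓ)
open import Relation.Binary using (DecTotalOrder; IsDecTotalOrder)
import Relation.Binary.Reasoning.PartialOrder as PartialOrderReasoning
open import Relation.Binary.PropositionalEquality using (_≡_; _≢_; refl; sym; trans; cong; cong₂; subst; subst₂; module ≡-Reasoning)
open import Relation.Nullary using (¬_; ¬?; Dec; does; yes; no; contradiction; _→-dec_; _×-dec_)
open import Relation.Nullary.Decidable using (decidable-stable)
open import Relation.Unary using (Decidable; Pred)

-- Arithmetic in ordered fields.

module OrderedFieldProperties (K : OrderedField) where
  open OrderedField K
  open CommutativeRing commutativeRing using (+-assoc; +-comm; +-identityˡ; +-identityʳ; -‿inverseˡ; -‿inverseʳ; *-comm; *-identityˡ; *-identityʳ; zeroʳ; *-assoc; commutativeSemiring; semiring)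
  open IsDecTotalOrder isDecTotalOrder using (antisym; total) renaming (refl to ≤-refl; reflexive to ≤-reflexive; trans to ≤-trans; _≟_ to _≟ᴿ_) public
  open Solver commutativeSemiring using (solve; con; _:+_; _:*_; _:=_) public
  open Sum (CommutativeRing.+-commutativeMonoid commutativeRing) using (sum-cong-≗; ∑-distrib-+; sum-replicate-zero)
  open SemiringSum semiring using (*-distribˡ-sum; *-distribʳ-sum)

  decTotalOrder : DecTotalOrder _ _ _
  decTotalOrder = record { isDecTotalOrder = isDecTotalOrder }

  module ≤-Reasoning = PartialOrderReasoning (DecTotalOrder.poset decTotalOrder)

  x-y+y : ∀ x y → (x - y) + y ≡ x
  x-y+y x y = trans (+-assoc x (- y) y) (trans (cong (x +_) (-‿inverseˡ y)) (+-identityʳ x))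

  x+y-y : ∀ x y → (x + y) - y ≡ x
  x+y-y x y = trans (+-assoc x y (- y)) (trans (cong (x +_) (-‿inverseʳ y)) (+-identityʳ x))

  x-0 : ∀ x → x - 0# ≡ x
  x-0 x = trans (sym (+-identityʳ (x - 0#))) (x-y+y x 0#)

  +-cancelʳ-≤ : ∀ z {x y} → x + z ≤ y + z → x ≤ y
  +-cancelʳ-≤ z {x} {y} p = subst₂ _≤_ (x+y-y x z) (x+y-y y z) (+-monoˡ-≤ (- z) p)

  +-monoʳ-≤ : ∀ z {x y} → x ≤ y → z + x ≤ z + y
  +-monoʳ-≤ z {x} {y} p = subst₂ _≤_ (+-comm x z) (+-comm y z) (+-monoˡ-≤ z p)

  +-mono-≤ : ∀ {w x y z} → w ≤ x → y ≤ z → w + y ≤ x + z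
  +-mono-≤ p q = ≤-trans (+-monoˡ-≤ _ p) (+-monoʳ-≤ _ q)

  -- Turns b - a ≡ y - x, rearranged so that it is a semiring identity, into
  -- an inequality.
  ≤-shift : ∀ {x y a b} → x ≤ y → a + y ≡ b + x → a ≤ b
  ≤-shift {x} {y} {a} {b} x≤y eq = +-cancelʳ-≤ y (subst (_≤ b + y) (sym eq) (+-monoʳ-≤ b x≤y))

  ≤⇒+ : ∀ {x y} → x ≤ y → ∃ λ d → 0# ≤ d × y ≡ x + d
  ≤⇒+ {x} {y} x≤y = y - x
    , subst (_≤ y - x) (-‿inverseʳ x) (+-monoˡ-≤ (- x) x≤y)
    , sym (trans (+-comm x (y - x)) (x-y+y y x))

  x≤y+z⇒x-z≤y : ∀ {x y z} → x ≤ y + z → x - z ≤ y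
  x≤y+z⇒x-z≤y {x} {y} {z} p = subst (x - z ≤_) (x+y-y y z) (+-monoˡ-≤ (- z) p)

  x-z≤y⇒x≤y+z : ∀ {x y z} → x - z ≤ y → x ≤ y + z
  x-z≤y⇒x≤y+z {x} {y} {z} p = subst (_≤ y + z) (x-y+y x z) (+-monoˡ-≤ z p)

  ≰⇒≥ : ∀ {x y} → ¬ (x ≤ y) → y ≤ x
  ≰⇒≥ {x} {y} x≰y with total x y
  ... | inj₁ x≤y = contradiction x≤y x≰y
  ... | inj₂ y≤x = y≤x

  <⇒≱ : ∀ {x y} → x < y → ¬ (y ≤ x)
  <⇒≱ (x≤y , x≢y) y≤x = x≢y (antisym x≤y y≤x)

  x≤x+y : ∀ {x y} → 0# ≤ y → x ≤ x + y
  x≤x+y {x} {y} 0≤y = subst (_≤ x + y) (+-identityʳ x) (+-monoʳ-≤ x 0≤y)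

  +-nonneg : ∀ {x y} → 0# ≤ x → 0# ≤ y → 0# ≤ x + y
  +-nonneg 0≤x 0≤y = ≤-trans 0≤x (x≤x+y 0≤y)

  *-monoˡ-≤ : ∀ {z x y} → 0# ≤ z → x ≤ y → z * x ≤ z * y
  *-monoˡ-≤ {z} {x} 0≤z x≤y with ≤⇒+ x≤y
  ... | d , 0≤d , refl = ≤-shift (*-nonneg 0≤z 0≤d)
    (solve 3 (λ z x d → z :* x :+ z :* d := z :* (x :+ d) :+ con 0) refl z x d)

  *-monoʳ-≤ : ∀ {z x y} → 0# ≤ z → x ≤ y → x * z ≤ y * z
  *-monoʳ-≤ {z} {x} {y} 0≤z x≤y = subst₂ _≤_ (*-comm z x) (*-comm z y) (*-monoˡ-≤ 0≤z x≤y)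

  -- Expands 0 ≤ (b - a)(d - c), with both differences replaced by nonnegative witnesses so that the
  -- semiring solver applies.
  rearrangement : ∀ {a b c d} → a ≤ b → c ≤ d → a * d + b * c ≤ a * c + b * d
  rearrangement {a} {c = c} a≤b c≤d with ≤⇒+ a≤b | ≤⇒+ c≤d
  ... | e , 0≤e , refl | f , 0≤f , refl = ≤-shift (*-nonneg 0≤e 0≤f)
    (solve 4 (λ a c e f → (a :* (c :+ f) :+ (a :+ e) :* c) :+ e :* f
                        := (a :* c :+ (a :+ e) :* (c :+ f)) :+ con 0) refl a c e f)

  0≤x*x : ∀ x → 0# ≤ x * x
  0≤x*x x with total 0# x
  ... | inj₁ 0≤x = *-nonneg 0≤x 0≤x
  ... | inj₂ x≤0 with ≤⇒+ x≤0
  -- Here `x + d` is 0, so d is -x, and multiples of `x + d` can be inserted and deleted to turn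
  -- `d * d` into `x * x`.
  ...   | d , 0≤d , eq = ≤-shift (*-nonneg 0≤d 0≤d) (begin
    0# + d * d              ≡⟨ +-identityˡ (d * d) ⟩
    d * d                   ≡⟨ +-identityʳ (d * d) ⟨
    d * d + 0#              ≡⟨ cong (d * d +_) (trans (*-comm 0# x) (zeroʳ x)) ⟨
    d * d + 0# * x          ≡⟨ cong (λ z → d * d + z * x) eq ⟩
    d * d + (x + d) * x     ≡⟨ solve 2 (λ d x → d :* d :+ (x :+ d) :* x := x :* x :+ d :* (x :+ d)) refl d x ⟩
    x * x + d * (x + d)     ≡⟨ cong (λ z → x * x + d * z) eq ⟨
    x * x + d * 0#          ≡⟨ cong (x * x +_) (zeroʳ d) ⟩
    x * x + 0#              ∎)
    where open ≡-Reasoning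

  0≤1 : 0# ≤ 1#
  0≤1 = subst (0# ≤_) (*-identityˡ 1#) (0≤x*x 1#)

  1≰0 : ¬ (1# ≤ 0#)
  1≰0 1≤0 = 0≢1 (antisym 0≤1 1≤0)

  ⁻¹-nonneg : ∀ {x} → 0# < x → 0# ≤ x ⁻¹
  ⁻¹-nonneg {x} (0≤x , 0≢x) with total 0# (x ⁻¹)
  ... | inj₁ p = p
  ... | inj₂ p = contradiction (subst₂ _≤_ (*-inverseʳ (0≢x ∘ sym)) (zeroʳ x) (*-monoˡ-≤ 0≤x p)) 1≰0

  1≤x⇒0<x : ∀ {x} → 1# ≤ x → 0# < x
  1≤x⇒0<x 1≤x = ≤-trans 0≤1 1≤x , λ { refl → 1≰0 1≤x }

  1≤x⇒x⁻¹≤1 : ∀ {x} → 1# ≤ x → x ⁻¹ ≤ 1#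
  1≤x⇒x⁻¹≤1 {x} 1≤x = subst₂ _≤_ (*-identityˡ _) (*-inverseʳ (proj₂ 0<x ∘ sym)) (*-monoʳ-≤ (⁻¹-nonneg 0<x) 1≤x)
    where 0<x = 1≤x⇒0<x 1≤x

  x⁻¹*[x*y]≡y : ∀ {x} y → x ≢ 0# → x ⁻¹ * (x * y) ≡ y
  x⁻¹*[x*y]≡y {x} y x≢0 = trans (sym (*-assoc (x ⁻¹) x y))
    (trans (cong (_* y) (trans (*-comm (x ⁻¹) x) (*-inverseʳ x≢0))) (*-identityˡ y))

  -- With α = 1 + e, multiplying by α gives x ≤ x + e x, and e is positive.
  scaled≤⇒nonneg : ∀ {α x} → 1# < α → α ⁻¹ * x ≤ x → 0# ≤ x
  scaled≤⇒nonneg {α} {x} (1≤α , 1≢α) scaled≤ with ≤⇒+ 1≤α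
  ... | e , 0≤e , refl = subst₂ _≤_ (zeroʳ (e ⁻¹)) (x⁻¹*[x*y]≡y x e≢0) (*-monoˡ-≤ (⁻¹-nonneg (0≤e , e≢0 ∘ sym)) 0≤e*x)
    where
    e≢0 : e ≢ 0#
    e≢0 refl = 1≢α (sym (+-identityʳ 1#))

    α≢0 : 1# + e ≢ 0#
    α≢0 = proj₂ (1≤x⇒0<x 1≤α) ∘ sym

    x≤αx : x ≤ (1# + e) * x
    x≤αx = subst (_≤ (1# + e) * x) (trans (trans (sym (*-assoc _ _ x)) (cong (_* x) (*-inverseʳ α≢0))) (*-identityˡ x))
      (*-monoˡ-≤ (proj₁ (1≤x⇒0<x 1≤α)) scaled≤)

    0≤e*x : 0# ≤ e * x
    0≤e*x = ≤-shift x≤αx (solve 2 (λ e x → con 0 :+ (con 1 :+ e) :* x := e :* x :+ x) refl e x)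

  -- Bounds an element of unknown sign by a positive expression built from sums and products only.
  -- It is applied to the given polynomial and to the maximum of `h`.
  x≤x*x+1 : ∀ x → x ≤ x * x + 1#
  x≤x*x+1 x with total x 1#
  ... | inj₁ x≤1 = ≤-trans x≤1 (subst (1# ≤_) (+-comm 1# (x * x)) (x≤x+y (0≤x*x x)))
  ... | inj₂ 1≤x = ≤-trans (subst (_≤ x * x) (*-identityʳ x) (*-monoˡ-≤ (≤-trans 0≤1 1≤x) 1≤x)) (x≤x+y 0≤1)

  x≤abs[x] : ∀ x → x ≤ abs x
  x≤abs[x] x with 0# ≤? x
  ... | yes _  = ≤-refl
  ... | no 0≰x with ≤⇒+ (≰⇒≥ 0≰x)
  ...   | d , 0≤d , eq = ≤-trans (≰⇒≥ 0≰x) (subst (0# ≤_) d≡-x 0≤d)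
    where
    open ≡-Reasoning
    d≡-x : d ≡ - x
    d≡-x = begin
      d             ≡⟨ x+y-y d x ⟨
      (d + x) - x   ≡⟨ cong (_- x) (trans (+-comm d x) (sym eq)) ⟩
      0# - x        ≡⟨ +-identityˡ (- x) ⟩
      - x           ∎

  -x≤abs[x] : ∀ x → - x ≤ abs x
  -x≤abs[x] x with 0# ≤? x
  ... | yes 0≤x = ≤-trans (subst₂ _≤_ (+-identityˡ (- x)) (-‿inverseʳ x) (+-monoˡ-≤ (- x) 0≤x)) 0≤x
  ... | no _    = ≤-refl

  abs[x-y]≤δ⇒x≤y+δ : ∀ {x y δ} → abs (x - y) ≤ δ → x ≤ y + δ
  abs[x-y]≤δ⇒x≤y+δ {x} {y} {δ} p =
    subst (x ≤_) (+-comm δ y) (x-z≤y⇒x≤y+z (≤-trans (x≤abs[x] (x - y)) p))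

  abs[x-y]≤δ⇒y≤x+δ : ∀ {x y δ} → abs (x - y) ≤ δ → y ≤ x + δ
  abs[x-y]≤δ⇒y≤x+δ {x} {y} {δ} p = ≤-shift (≤-trans (-x≤abs[x] (x - y)) p) (begin
    y + δ                      ≡⟨ cong (_+ δ) (+-identityʳ y) ⟨
    y + 0# + δ                 ≡⟨ cong (λ z → y + z + δ) (-‿inverseʳ (x - y)) ⟨
    y + ((x - y) - (x - y)) + δ ≡⟨ solve 4 (λ w y z d → y :+ (w :+ z) :+ d := (w :+ y) :+ d :+ z) refl (x - y) y (- (x - y)) δ ⟩
    (x - y) + y + δ + - (x - y) ≡⟨ cong (λ z → z + δ + - (x - y)) (x-y+y x y) ⟩
    x + δ + - (x - y)          ∎)
    where open ≡-Reasoning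

  fromℕ-nonneg : ∀ n → 0# ≤ fromℕ n
  fromℕ-nonneg zero    = ≤-refl
  fromℕ-nonneg (suc n) = +-nonneg 0≤1 (fromℕ-nonneg n)

  fromℕ-+ : ∀ m n → fromℕ (m ℕ.+ n) ≡ fromℕ m + fromℕ n
  fromℕ-+ zero    n = sym (+-identityˡ _)
  fromℕ-+ (suc m) n = trans (cong (1# +_) (fromℕ-+ m n)) (sym (+-assoc _ _ _))

  fromℕ-* : ∀ m n → fromℕ (m ℕ.* n) ≡ fromℕ m * fromℕ n
  fromℕ-* zero    n = trans (sym (zeroʳ (fromℕ n))) (*-comm (fromℕ n) 0#)
  fromℕ-* (suc m) n = trans (fromℕ-+ n (m ℕ.* n)) (trans (cong (fromℕ n +_) (fromℕ-* m n))
    (solve 2 (λ a b → b :+ a :* b := (con 1 :+ a) :* b) refl (fromℕ m) (fromℕ n)))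

  fromℕ-mono : ∀ {m n} → m ℕ.≤ n → fromℕ m ≤ fromℕ n
  fromℕ-mono {n = n} ℕ.z≤n = fromℕ-nonneg n
  fromℕ-mono (ℕ.s≤s m≤n)   = +-monoʳ-≤ 1# (fromℕ-mono m≤n)

  -- Finite sums, expectations and their perturbation.

  sum-mono-≤ : ∀ {n} {x y : Fin n → Carrier} → (∀ i → x i ≤ y i) → sum x ≤ sum y
  sum-mono-≤ {zero}  p = ≤-refl
  sum-mono-≤ {suc n} p = +-mono-≤ (p zero) (sum-mono-≤ (p ∘ suc))

  sum-nonneg : ∀ {n} {x : Fin n → Carrier} → (∀ i → 0# ≤ x i) → 0# ≤ sum x
  sum-nonneg {n} p = ≤-trans (≤-reflexive (sym (sum-replicate-zero n))) (sum-mono-≤ p)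

  sum-const : ∀ n z → sum {n} (λ _ → z) ≡ fromℕ n * z
  sum-const zero    z = trans (sym (zeroʳ z)) (*-comm z 0#)
  sum-const (suc n) z = trans (cong (z +_) (sum-const n z))
    (solve 2 (λ a z → z :+ a :* z := (con 1 :+ a) :* z) refl (fromℕ n) z)

  sumOver-0 : ∀ {n} (I : Subset n) → sumOver I (λ _ → 0#) ≡ 0#
  sumOver-0 {n} I = trans (sum-cong-≗ (λ i → if-eta (Vec.lookup I i))) (sum-replicate-zero n)

  -- All n indices are charged δ, including those outside I, so the bound does not depend on the
  -- size of I.
  sumOver-≤+ : ∀ {n} (I : Subset n) {x y : Fin n → Carrier} {δ} → 0# ≤ δ →
               (∀ i → i ∈ I → x i ≤ y i + δ) → sumOver I x ≤ sumOver I y + fromℕ n * δ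
  sumOver-≤+ {n} I {x} {y} {δ} 0≤δ p = ≤-trans (sum-mono-≤ (λ i → pointwise i))
    (≤-reflexive (trans (∑-distrib-+ (λ i → if Vec.lookup I i then y i else 0#) (λ _ → δ))
                        (cong (sumOver I y +_) (sum-const n δ))))
    where
    pointwise : ∀ i → (if Vec.lookup I i then x i else 0#) ≤ (if Vec.lookup I i then y i else 0#) + δ
    pointwise i with Vec.lookup I i in eq
    ... | true  = p i (lookup⇒[]= i I eq)
    ... | false = subst (0# ≤_) (sym (+-identityˡ δ)) 0≤δ

  sumOver-∅ : ∀ {n} (x : Fin n → Carrier) → sumOver ∅ x ≡ 0#
  sumOver-∅ {zero}  x = refl
  sumOver-∅ {suc n} x = trans (+-identityˡ _) (sumOver-∅ (x ∘ suc))

  sumOver-nonpos : ∀ {n} (I : Subset n) {x : Fin n → Carrier} → (∀ i → x i ≤ 0#) → sumOver I x ≤ 0#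
  sumOver-nonpos Vec.[]          p = ≤-refl
  sumOver-nonpos (true Vec.∷ I)  p = ≤-trans (+-mono-≤ (p zero) (sumOver-nonpos I (p ∘ suc))) (≤-reflexive (+-identityˡ 0#))
  sumOver-nonpos (false Vec.∷ I) p = ≤-trans (≤-reflexive (+-identityˡ _)) (sumOver-nonpos I (p ∘ suc))

  sumOver≤term : ∀ {n} {I : Subset n} {x : Fin n → Carrier} {i} → i ∈ I → (∀ j → x j ≤ 0#) → sumOver I x ≤ x i
  sumOver≤term {I = _ Vec.∷ I} Vec.here p = ≤-trans (+-monoʳ-≤ _ (sumOver-nonpos I (p ∘ suc))) (≤-reflexive (+-identityʳ _))
  sumOver≤term {I = true Vec.∷ I} (Vec.there i∈I) p = ≤-trans (+-mono-≤ (p zero) (sumOver≤term i∈I (p ∘ suc))) (≤-reflexive (+-identityˡ _))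
  sumOver≤term {I = false Vec.∷ I} (Vec.there i∈I) p = ≤-trans (≤-reflexive (+-identityˡ _)) (sumOver≤term i∈I (p ∘ suc))

  sumOver-nonneg : ∀ {n} (I : Subset n) {x : Fin n → Carrier} → (∀ i → i ∈ I → 0# ≤ x i) → 0# ≤ sumOver I x
  sumOver-nonneg I {x} p = sum-nonneg pointwise
    where
    pointwise : ∀ i → 0# ≤ (if Vec.lookup I i then x i else 0#)
    pointwise i with Vec.lookup I i in eq
    ... | true  = p i (lookup⇒[]= i I eq)
    ... | false = ≤-refl

  sumOver≤ : ∀ {n} (I : Subset n) (x : Fin n → Carrier) {z} → 0# ≤ z →
             (∀ i → i ∈ I → x i ≤ z) → sumOver I x ≤ fromℕ n * z
  sumOver≤ {n} I x {z} 0≤z p = ≤-trans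
    (sumOver-≤+ I {x} {λ _ → 0#} 0≤z (λ i i∈I → subst (x i ≤_) (sym (+-identityˡ z)) (p i i∈I)))
    (≤-reflexive (trans (cong (_+ fromℕ n * z) (sumOver-0 I)) (+-identityˡ _)))

  module _ {m : ℕ} (μ ν φ : Fin m → Carrier) where

    -- With A = {v | ν v ≤ μ v}, every term of Σ (μ - ν)(φ - lo) outside A is
    -- nonpositive, and every term in A is at most (μ - ν)ρ.
    sum-close : ∀ {δ lo ρ} → sum μ ≡ sum ν → (∀ A → sumOver A μ ≤ sumOver A ν + δ) →
                0# ≤ ρ → (∀ v → lo ≤ φ v) → (∀ v → φ v ≤ lo + ρ) →
                sum (λ v → μ v * φ v) ≤ sum (λ v → ν v * φ v) + ρ * δ
    sum-close {δ} {lo} {ρ} μ≡ν close 0≤ρ lo≤φ φ≤hi =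
      ≤-shift (+-mono-≤ summed (*-monoˡ-≤ 0≤ρ (close A))) identity
      where
      A : Subset m
      A = Vec.tabulate (λ v → does (ν v ≤? μ v))

      onA : (Fin m → Carrier) → Fin m → Carrier
      onA x v = if Vec.lookup A v then x v else 0#

      -- The bound on (μ - ν)(φ - lo), with all subtracted terms moved to the other side.
      pointwise : ∀ v → μ v * φ v + (ρ * onA ν v + lo * ν v) ≤ ν v * φ v + (ρ * onA μ v + lo * μ v)
      pointwise v rewrite lookup∘tabulate (λ v → does (ν v ≤? μ v)) v with ν v ≤? μ v
      ... | yes ν≤μ = ≤-shift (rearrangement ν≤μ (φ≤hi v))
        (solve 5 (λ μ ν φ ρ lo → (μ :* φ :+ (ρ :* ν :+ lo :* ν)) :+ (ν :* φ :+ μ :* (lo :+ ρ))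
                              := (ν :* φ :+ (ρ :* μ :+ lo :* μ)) :+ (ν :* (lo :+ ρ) :+ μ :* φ))
               refl (μ v) (ν v) (φ v) ρ lo)
      ... | no ν≰μ  = ≤-shift (rearrangement (≰⇒≥ ν≰μ) (lo≤φ v))
        (solve 5 (λ μ ν φ ρ lo → (μ :* φ :+ (ρ :* con 0 :+ lo :* ν)) :+ (μ :* lo :+ ν :* φ)
                              := (ν :* φ :+ (ρ :* con 0 :+ lo :* μ)) :+ (μ :* φ :+ ν :* lo))
               refl (μ v) (ν v) (φ v) ρ lo)

      expand : ∀ (x y z : Fin m → Carrier) →
               sum (λ v → x v + (ρ * y v + lo * z v)) ≡ sum x + (ρ * sum y + lo * sum z)
      expand x y z = begin
        sum (λ v → x v + (ρ * y v + lo * z v))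
          ≡⟨ ∑-distrib-+ x (λ v → ρ * y v + lo * z v) ⟩
        sum x + sum (λ v → ρ * y v + lo * z v)
          ≡⟨ cong (sum x +_) (∑-distrib-+ (λ v → ρ * y v) (λ v → lo * z v)) ⟩
        sum x + (sum (λ v → ρ * y v) + sum (λ v → lo * z v))
          ≡⟨ cong (sum x +_) (cong₂ _+_ (*-distribˡ-sum ρ y) (*-distribˡ-sum lo z)) ⟨
        sum x + (ρ * sum y + lo * sum z) ∎
        where open ≡-Reasoning

      summed : sum (λ v → μ v * φ v) + (ρ * sumOver A ν + lo * sum ν)
               ≤ sum (λ v → ν v * φ v) + (ρ * sumOver A μ + lo * sum μ)
      summed = subst₂ _≤_ (expand (λ v → μ v * φ v) (onA ν) ν) (expand (λ v → ν v * φ v) (onA μ) μ)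
        (sum-mono-≤ pointwise)

      identity : sum (λ v → μ v * φ v) + ((sum (λ v → ν v * φ v) + (ρ * sumOver A μ + lo * sum μ)) + ρ * (sumOver A ν + δ))
               ≡ (sum (λ v → ν v * φ v) + ρ * δ) + ((sum (λ v → μ v * φ v) + (ρ * sumOver A ν + lo * sum ν)) + ρ * sumOver A μ)
      -- Equal total masses make the `lo` terms cancel, so only the width ρ of the interval matters
      -- and not its location.
      identity rewrite μ≡ν = solve 7
        (λ x y ρ lo a b δs → x :+ ((y :+ (ρ :* a :+ lo)) :+ ρ :* (b :+ δs))
                           := (y :+ ρ :* δs) :+ ((x :+ (ρ :* b :+ lo)) :+ ρ :* a))
        refl (sum (λ v → μ v * φ v)) (sum (λ v → ν v * φ v)) ρ (lo * sum ν) (sumOver A μ) (sumOver A ν) δ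

  sum-mean-const : ∀ {m} (μ : Fin m → Carrier) z → sum μ ≡ 1# → sum (λ v → μ v * z) ≡ z
  sum-mean-const μ z μ≡1 =
    trans (sym (*-distribʳ-sum z μ)) (trans (cong (_* z) μ≡1) (*-identityˡ z))

  sum-mean : ∀ {m} (μ φ : Fin m → Carrier) z → sum μ ≡ 1# →
             sum (λ v → μ v * (φ v + z)) ≡ sum (λ v → μ v * φ v) + z
  sum-mean μ φ z μ≡1 = begin
    sum (λ v → μ v * (φ v + z))                    ≡⟨ sum-cong-≗ (λ v → solve 3 (λ m f z → m :* (f :+ z) := m :* f :+ m :* z) refl (μ v) (φ v) z) ⟩
    sum (λ v → μ v * φ v + μ v * z)                ≡⟨ ∑-distrib-+ (λ v → μ v * φ v) (λ v → μ v * z) ⟩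
    sum (λ v → μ v * φ v) + sum (λ v → μ v * z)    ≡⟨ cong (sum (λ v → μ v * φ v) +_) (sum-mean-const μ z μ≡1) ⟩
    sum (λ v → μ v * φ v) + z                      ∎
    where open ≡-Reasoning

  -- Terms of probability 0 need no bound.
  sum-mean-mono : ∀ {m} {μ φ ψ : Fin m → Carrier} → (∀ v → 0# ≤ μ v) →
                  (∀ v → 0# < μ v → φ v ≤ ψ v) →
                  sum (λ v → μ v * φ v) ≤ sum (λ v → μ v * ψ v)
  sum-mean-mono {μ = μ} {φ} {ψ} 0≤μ p = sum-mono-≤ λ v → pointwise v
    where
    pointwise : ∀ v → μ v * φ v ≤ μ v * ψ v
    pointwise v with 0# ≟ᴿ μ v
    ... | yes eq = ≤-reflexive (trans (vanish (φ v)) (sym (vanish (ψ v))))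
      where
      vanish : ∀ z → μ v * z ≡ 0#
      vanish z = trans (*-comm (μ v) z) (trans (cong (z *_) (sym eq)) (zeroʳ z))
    ... | no 0≢μ = *-monoˡ-≤ (0≤μ v) (p v (0≤μ v , 0≢μ))

  mean≤ : ∀ {m} {μ φ : Fin m → Carrier} {z} → (∀ v → 0# ≤ μ v) → sum μ ≡ 1# →
          (∀ v → 0# < μ v → φ v ≤ z) → sum (λ v → μ v * φ v) ≤ z
  mean≤ {μ = μ} {z = z} 0≤μ μ≡1 p = ≤-trans (sum-mean-mono 0≤μ p) (≤-reflexive (sum-mean-const μ z μ≡1))

  ≤mean : ∀ {m} {μ φ : Fin m → Carrier} {z} → (∀ v → 0# ≤ μ v) → sum μ ≡ 1# →
          (∀ v → 0# < μ v → z ≤ φ v) → z ≤ sum (λ v → μ v * φ v)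
  ≤mean {μ = μ} {z = z} 0≤μ μ≡1 p = ≤-trans (≤-reflexive (sym (sum-mean-const μ z μ≡1))) (sum-mean-mono 0≤μ p)

-- Enumeration of subsets, and sums and maxima of natural numbers.

subsets : ∀ n → List (Subset n)
subsets zero    = [ Vec.[] ]
subsets (suc n) = map (true Vec.∷_) (subsets n) ++ map (false Vec.∷_) (subsets n)

∈-subsets : ∀ {n} (I : Subset n) → I List.∈ subsets n
∈-subsets Vec.[]            = here refl
∈-subsets (true  Vec.∷ I)   = ∈-++⁺ˡ (∈-map⁺ _ (∈-subsets I))
∈-subsets (false Vec.∷ I)   = ∈-++⁺ʳ _ (∈-map⁺ _ (∈-subsets I))

module _ {A B : Set} {X : Pred B 0ℓ} {g : A → List B} where

  All-concatMap⁺ : ∀ xs → (∀ x → All X (g x)) → All X (concatMap g xs)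
  All-concatMap⁺ xs p = All.concat⁺ (All.map⁺ (All.universal p xs))

  Any-concatMap⁺ : ∀ {x xs} → x List.∈ xs → Any X (g x) → Any X (concatMap g xs)
  Any-concatMap⁺ x∈xs p = Any.concatMap⁺ g (Any.map (λ { refl → p }) x∈xs)

sumℕ : ∀ {n} → (Fin n → ℕ) → ℕ
sumℕ = Vector.foldr ℕ._+_ 0

sumℕ-pred : ∀ {n} (b : Fin n → ℕ) i → 0 ℕ.< b i → suc (sumℕ (Vector.updateAt b i ℕ.pred)) ≡ sumℕ b
sumℕ-pred b zero    0<b = cong (ℕ._+ sumℕ (b ∘ suc)) (ℕ.suc-pred (b zero) {{ℕ.>-nonZero 0<b}})
sumℕ-pred b (suc i) 0<b = trans (sym (ℕ.+-suc _ _)) (cong (b zero ℕ.+_) (sumℕ-pred (b ∘ suc) i 0<b))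

sumℕ≤0⇒≤0 : ∀ {n} (b : Fin n → ℕ) → sumℕ b ℕ.≤ 0 → ∀ i → b i ℕ.≤ 0
sumℕ≤0⇒≤0 b p zero    = ℕ.≤-trans (ℕ.m≤m+n _ _) p
sumℕ≤0⇒≤0 b p (suc i) = sumℕ≤0⇒≤0 (b ∘ suc) (ℕ.≤-trans (ℕ.m≤n+m _ _) p) i

sumℕ-const : ∀ n D → sumℕ {n} (λ _ → D) ≡ n ℕ.* D
sumℕ-const zero    D = refl
sumℕ-const (suc n) D = cong (D ℕ.+_) (sumℕ-const n D)

≤-foldr-⊔ : ∀ {n} (d : Fin n → ℕ) i → d i ℕ.≤ Vector.foldr ℕ._⊔_ 0 d
≤-foldr-⊔ d zero    = ℕ.m≤m⊔n _ _
≤-foldr-⊔ d (suc i) = ℕ.≤-trans (≤-foldr-⊔ (d ∘ suc) i) (ℕ.m≤n⊔m (d zero) _)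

module _ (K : OrderedField) where
  open MPOI K
  open OrderedFieldProperties K
  open CommutativeRing commutativeRing using (+-assoc; +-comm; +-identityˡ; *-identityˡ; *-identityʳ; -‿inverseʳ; +-abelianGroup)
  open AbelianGroupProperties +-abelianGroup using (⁻¹-∙-comm)
  open Sum (CommutativeRing.+-commutativeMonoid commutativeRing) using (sum-cong-≗)
  open Extrema (DecTotalOrder.totalOrder decTotalOrder) using (argmax; argmax-all; f[xs]≤f[argmax]; f[⊥]≤f[argmax]; f[argmax]≤v⁺; v≤f[argmax]⁺)
  open Extrema ℕ.≤-totalOrder using (argmin; argmin-all; f[argmin]≤f[xs])
  open Min (DecTotalOrder.totalOrder decTotalOrder) using (_⊓_; x⊓y≤x; x⊓y≤y; ⊓-glb)

  -- Maximizing `h` over the feasible sets.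

  module _ {n k} (Q : Packing n k) where
    open Packing Q

    𝓕-∅ : 𝓕 ∅
    𝓕-∅ = downClosed ⊥⊆ (proj₁ (proj₂ rankAttained))

    -- The default `∅` is itself feasible by downward closure, so the maximum ranges over feasible
    -- sets only.
    bestSet : Subset n
    bestSet = argmax h ∅ (filter 𝓕? (subsets n))

    bestSet-feasible : 𝓕 bestSet
    bestSet-feasible = argmax-all h 𝓕-∅ (All.all-filter 𝓕? (subsets n))

    f[∅]≡h[∅] : ∀ x → f ∅ x ≡ h ∅
    f[∅]≡h[∅] x = trans (cong (_+ h ∅) (sumOver-∅ x)) (+-identityˡ (h ∅))

    h≤h[bestSet] : ∀ {I} → 𝓕 I → h I ≤ h bestSet
    h≤h[bestSet] I∈𝓕 = All.lookup (f[xs]≤f[argmax] ∅ (filter 𝓕? (subsets n))) (∈-filter⁺ 𝓕? (∈-subsets _) I∈𝓕)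

  -- Values to go and budgets of transitions.

  module _ {n k} (Q : Packing n k) {m : Fin n → ℕ} {s : ∀ i → Fin (m i)}
           {T : ∀ i → Subset (m i)} (S : ∀ i → MarkovSystem (s i) (T i)) where
    open Packing Q
    private module S i = MarkovSystem (S i)

    -- The Bellman form of `expectation`: each price is subtracted at the step that incurs it, so no
    -- history has to be carried along.
    value : ∀ {σ} → Strategy Q T σ → R
    value {σ} (select I _ _)     = f I (λ i → S.r i (σ i))
    value {σ} (advance i _ next) = sum (λ v → S.P i (σ i) v * value (next v)) - S.π i (σ i)

    -- Transition probabilities sum to one, so an amount already paid passes through every
    -- expectation unchanged.
    expectation≡value- : ∀ {σ} c (τ : Strategy Q T σ) → expectation Q S c τ ≡ value τ - c
    expectation≡value- c (select _ _ _) = refl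
    expectation≡value- {σ} c (advance i _ next) = begin
      sum (λ v → P v * expectation Q S (c + π₀) (next v))
        ≡⟨ sum-cong-≗ (λ v → cong (P v *_) (expectation≡value- (c + π₀) (next v))) ⟩
      sum (λ v → P v * (value (next v) - (c + π₀)))
        ≡⟨ sum-mean P (λ v → value (next v)) (- (c + π₀)) (S.P-sum i (σ i)) ⟩
      E - (c + π₀)
        ≡⟨ cong (E +_) (trans (cong -_ (+-comm c π₀)) (sym (⁻¹-∙-comm π₀ c))) ⟩
      E + (- π₀ + - c)
        ≡⟨ +-assoc E (- π₀) (- c) ⟨
      E - π₀ - c ∎
      where
      open ≡-Reasoning
      P = S.P i (σ i)
      π₀ = S.π i (σ i)
      E = sum (λ v → P v * value (next v))

    utility≡value : ∀ τ → utility Q S τ ≡ value τ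
    utility≡value τ = trans (expectation≡value- 0# τ) (x-0 (value τ))

    -- At most t further transitions of positive probability can be made from σ.
    record Budget (t : ℕ) (σ : ∀ i → Fin (m i)) : Set where
      field
        remaining : Fin n → ℕ
        bounds    : ∀ i w ℓ → Path (T i) (S.P i) ℓ (σ i) w → ℓ ℕ.≤ remaining i
        total     : sumℕ remaining ℕ.≤ t
    open Budget

    -- A non-destination state reaches a destination only by a path with at least one transition,
    -- and the budget covers that path.
    positive : ∀ {t σ} (b : Budget t σ) i → σ i ∉ T i → 0 ℕ.< remaining b i
    positive {σ = σ} b i σᵢ∉T with S.reaches i (σ i)
    ... | _ , _     , t∈T , []            = contradiction t∈T σᵢ∉T
    ... | w , suc ℓ , _   , path@(_ ∷ _)  = ℕ.≤-trans (ℕ.s≤s ℕ.z≤n) (bounds b i w (suc ℓ) path)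

    exhausted : ∀ {σ} → Budget 0 σ → ∀ i → ¬ (σ i ∉ T i)
    exhausted b i σᵢ∉T = ℕ.<⇒≱ (positive b i σᵢ∉T) (sumℕ≤0⇒≤0 (remaining b) (total b) i)

    spend : ∀ {t σ} → Budget (suc t) σ → ∀ i → σ i ∉ T i → ∀ v → 0# < S.P i (σ i) v → Budget t (σ [ i ≔ v ])
    spend {t} {σ} b i σᵢ∉T v 0<P = record
      { remaining = remaining′
      ; bounds    = bounds′
      ; total     = ℕ.≤-pred (subst (ℕ._≤ suc t) (sym (sumℕ-pred (remaining b) i (positive b i σᵢ∉T))) (total b))
      }
      where
      remaining′ = Vector.updateAt (remaining b) i ℕ.pred

      bounds′ : ∀ j w ℓ → Path (T j) (S.P j) ℓ ((σ [ i ≔ v ]) j) w → ℓ ℕ.≤ remaining′ j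
      bounds′ j w ℓ path with i ≟ j
      -- Prepending the transition just made to a path from v gives a path from the old state,
      -- longer by one.
      ... | yes refl = subst (ℓ ℕ.≤_) (sym (updateAt-updates i (remaining b)))
                         (ℕ.pred-mono-≤ (bounds b i w (suc ℓ) ((σᵢ∉T , 0<P) ∷ path)))
      ... | no i≢j   = subst (ℓ ℕ.≤_) (sym (updateAt-minimal j i (remaining b) (i≢j ∘ sym)))
                         (bounds b j w ℓ path)

    initialBudget : ∀ {D} → HasMaxDepth S D → Budget (n ℕ.* D) s
    initialBudget {D} (d , isDepth , refl) = record
      { remaining = λ _ → D
      ; bounds    = λ i w ℓ path → ℕ.≤-trans (proj₂ (isDepth i) w ℓ path) (≤-foldr-⊔ d i)
      ; total     = ℕ.≤-reflexive (sumℕ-const n D)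
      }

  -- Backward induction on the estimated systems.

  -- Values are clipped at b, and at every joint state the planner may give up
  -- optimizing and finish all systems in order to select bestSet.  These two
  -- devices confine the planned values to an interval of length (n + N) b,
  -- however large h is.
  module Planning {n k} (Q : Packing n k) (N : ℕ) (b : R) {m : Fin n → ℕ} {s : ∀ i → Fin (m i)}
                  {T : ∀ i → Subset (m i)} (Ŝ : ∀ i → MarkovSystem (s i) (T i)) where
    open Packing Q
    private module Ŝ i = MarkovSystem (Ŝ i)

    complete : ℕ → ∀ σ → Strategy Q T σ
    complete t σ with any? (λ i → ¬? (σ i ∈? T i))
    complete t       σ | no all-ready    = select (bestSet Q) (bestSet-feasible Q)
      (λ i _ → decidable-stable (σ i ∈? T i) (λ σᵢ∉T → all-ready (i , σᵢ∉T)))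
    -- A placeholder for running out of fuel with a system unfinished. A joint state with a `Budget`
    -- of zero cannot get here.
    complete zero    σ | yes _           = select ∅ (𝓕-∅ Q) (λ i i∈∅ → contradiction i∈∅ ∉⊥)
    complete (suc t) σ | yes (i , σᵢ∉T)  = advance i σᵢ∉T (λ v → complete t (σ [ i ≔ v ]))

    -- The first component is what the planner credits to the strategy, which may differ from its
    -- value under either the estimated or the true parameters.
    Option : (∀ i → Fin (m i)) → Set
    Option σ = R × Strategy Q T σ

    clippedValues : (∀ i → Fin (m i)) → Fin n → R
    clippedValues σ i = Ŝ.r i (σ i) ⊓ b

    selection : ∀ σ → Subset n → List (Option σ)
    selection σ I with 𝓕? I | all? (λ i → i ∈? I →-dec σ i ∈? T i)
    ... | yes I∈𝓕 | yes ready = [ f I (clippedValues σ) , select I I∈𝓕 ready ]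
    ... | _       | _         = []

    advanceValue : (∀ σ → Option σ) → ∀ σ → Fin n → R
    advanceValue next σ i = sum (λ v → Ŝ.P i (σ i) v * proj₁ (next (σ [ i ≔ v ]))) - Ŝ.π i (σ i)

    advancing : (∀ σ → Option σ) → ∀ σ → Fin n → List (Option σ)
    advancing next σ i with σ i ∈? T i
    ... | yes _     = []
    ... | no σᵢ∉T   = [ advanceValue next σ i , advance i σᵢ∉T (λ v → proj₂ (next (σ [ i ≔ v ]))) ]

    -- The credit for `complete`: it pays for at most N transitions at prices of at most b and then
    -- selects `bestSet` with nonnegative values.
    lowest : R
    lowest = h (bestSet Q) - fromℕ N * b

    selections : ∀ σ → List (Option σ)
    selections σ = concatMap (selection σ) (subsets n)

    plan    : ℕ → ∀ σ → Option σ
    options : ℕ → ∀ σ → List (Option σ)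
    -- As the default of `argmax`, the `complete` option is available at every joint state.
    plan t σ = argmax proj₁ (lowest , complete t σ) (options t σ)
    options zero    σ = selections σ
    options (suc t) σ = selections σ ++ concatMap (advancing (plan t) σ) (allFin n)

    plannedValue : ℕ → (∀ i → Fin (m i)) → R
    plannedValue t σ = proj₁ (plan t σ)

    plannedStrategy : ℕ → ∀ σ → Strategy Q T σ
    plannedStrategy t σ = proj₂ (plan t σ)

    module _ {σ} {X : Pred (Option σ) 0ℓ}
             (X-select : ∀ I I∈𝓕 ready → X (f I (clippedValues σ) , select I I∈𝓕 ready)) where

      All-selections : All X (selections σ)
      All-selections = All-concatMap⁺ (subsets n) all-selection
        where
        all-selection : ∀ I → All X (selection σ I)
        all-selection I with 𝓕? I | all? (λ i → i ∈? I →-dec σ i ∈? T i)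
        ... | yes I∈𝓕 | yes ready = X-select I I∈𝓕 ready ∷ []
        ... | yes _   | no _      = []
        ... | no _    | yes _     = []
        ... | no _    | no _      = []

      -- The equation `t ≡ suc t′` makes the advance case vacuous at horizon zero, so one lemma
      -- serves both clauses of `options`.
      All-options : ∀ t →
        (∀ t′ → t ≡ suc t′ → ∀ i σᵢ∉T → X (advanceValue (plan t′) σ i , advance i σᵢ∉T (λ v → plannedStrategy t′ (σ [ i ≔ v ])))) →
        All X (options t σ)
      All-options zero    _         = All-selections
      All-options (suc t) X-advance = All.++⁺ All-selections (All-concatMap⁺ (allFin n) all-advancing)
        where
        all-advancing : ∀ i → All X (advancing (plan t) σ i)
        all-advancing i with σ i ∈? T i
        ... | yes _   = []
        ... | no σᵢ∉T = X-advance t refl i σᵢ∉T ∷ []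

    select≤planned : ∀ t σ I → 𝓕 I → (∀ i → i ∈ I → σ i ∈ T i) → f I (clippedValues σ) ≤ plannedValue t σ
    select≤planned t σ I I∈𝓕 ready = v≤f[argmax]⁺ {f = proj₁} _ (options t σ) (inj₂ (any-options t))
      where
      any-selection : Any (λ o → f I (clippedValues σ) ≤ proj₁ o) (selection σ I)
      any-selection with 𝓕? I | all? (λ i → i ∈? I →-dec σ i ∈? T i)
      ... | yes _    | yes _      = here ≤-refl
      ... | yes _    | no ¬ready  = contradiction ready ¬ready
      ... | no I∉𝓕   | _          = contradiction I∈𝓕 I∉𝓕

      any-options : ∀ t → Any (λ o → f I (clippedValues σ) ≤ proj₁ o) (options t σ)
      any-options zero    = Any-concatMap⁺ (∈-subsets I) any-selection
      any-options (suc t) = Any.++⁺ˡ (Any-concatMap⁺ (∈-subsets I) any-selection)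

    advance≤planned : ∀ t σ i → σ i ∉ T i → advanceValue (plan t) σ i ≤ plannedValue (suc t) σ
    advance≤planned t σ i σᵢ∉T = v≤f[argmax]⁺ {f = proj₁} _ (options (suc t) σ)
      (inj₂ (Any.++⁺ʳ (selections σ) (Any-concatMap⁺ (∈-allFin i) any-advancing)))
      where
      any-advancing : Any (λ o → advanceValue (plan t) σ i ≤ proj₁ o) (advancing (plan t) σ i)
      any-advancing with σ i ∈? T i
      ... | yes σᵢ∈T = contradiction σᵢ∈T σᵢ∉T
      ... | no _     = here ≤-refl

    lowest≤planned : ∀ t σ → lowest ≤ plannedValue t σ
    lowest≤planned t σ = f[⊥]≤f[argmax] {f = proj₁} _ (options t σ)

    -- Chosen so that `lowest + spread` is `h (bestSet Q)` plus n b, which bounds the credit of any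
    -- selection with clipped values.
    spread : R
    spread = (fromℕ n + fromℕ N) * b

    module _ (0≤b : 0# ≤ b) where

      0≤spread : 0# ≤ spread
      0≤spread = *-nonneg (+-nonneg (fromℕ-nonneg n) (fromℕ-nonneg N)) 0≤b

      -- Induction on t: advancing averages values below the bound and then subtracts a nonnegative
      -- price.
      planned≤lowest+spread : ∀ t σ → plannedValue t σ ≤ lowest + spread
      planned≤lowest+spread t σ = f[argmax]≤v⁺ {f = proj₁} (x≤x+y 0≤spread) (All-options select≤ t advance≤)
        where
        lowest+spread : lowest + spread ≡ fromℕ n * b + h (bestSet Q)
        lowest+spread = begin
          lowest + spread                          ≡⟨ solve 4 (λ l n N b → l :+ (n :+ N) :* b := n :* b :+ (l :+ N :* b)) refl lowest (fromℕ n) (fromℕ N) b ⟩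
          fromℕ n * b + (lowest + fromℕ N * b)     ≡⟨ cong (fromℕ n * b +_) (x-y+y _ _) ⟩
          fromℕ n * b + h (bestSet Q)              ∎
          where open ≡-Reasoning

        select≤ : ∀ I → 𝓕 I → (∀ i → i ∈ I → σ i ∈ T i) → f I (clippedValues σ) ≤ lowest + spread
        select≤ I I∈𝓕 _ = subst (f I (clippedValues σ) ≤_) (sym lowest+spread)
          (+-mono-≤ (sumOver≤ I (clippedValues σ) 0≤b (λ i _ → x⊓y≤y _ b)) (h≤h[bestSet] Q I∈𝓕))

        advance≤ : ∀ t′ → t ≡ suc t′ → ∀ i → σ i ∉ T i → advanceValue (plan t′) σ i ≤ lowest + spread
        advance≤ t′ refl i σᵢ∉T = x≤y+z⇒x-z≤y (≤-trans
          (mean≤ (Ŝ.P-nonneg i (σ i)) (Ŝ.P-sum i (σ i)) (λ v _ → planned≤lowest+spread t′ (σ [ i ≔ v ])))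
          (x≤x+y (Ŝ.π-nonneg i σᵢ∉T)))

    -- Comparison of the plan with the true systems.

    module Robustness (S : ∀ i → MarkovSystem (s i) (T i)) {δ : R} (0≤b : 0# ≤ b) (0≤δ : 0# ≤ δ)
                      (close : ∀ i → Close δ (Ŝ i) (S i)) (nonneg : ∀ i → NonNegativeValues (S i))
                      (bounded : ∀ i → BoundedBy (S i) b) where
      private
        module S i = MarkovSystem (S i)
        module Ŝ≈S i = Close (close i)

      -- Starts at n δ, for the values in the final selection, and grows by (1 + spread) δ per
      -- transition: δ for the price and `spread * δ` for the transition probabilities.
      error : ℕ → R
      error t = (fromℕ n + fromℕ t * (1# + spread)) * δ

      n*δ≤error : ∀ t → fromℕ n * δ ≤ error t
      n*δ≤error t = *-monoʳ-≤ 0≤δ (x≤x+y (*-nonneg (fromℕ-nonneg t) (+-nonneg 0≤1 (0≤spread 0≤b))))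

      0≤error : ∀ t → 0# ≤ error t
      0≤error t = ≤-trans (*-nonneg (fromℕ-nonneg n) 0≤δ) (n*δ≤error t)

      next : ℕ → (∀ i → Fin (m i)) → ∀ i → Fin (m i) → R
      next t σ i v = plannedValue t (σ [ i ≔ v ])

      module _ (t : ℕ) (σ : ∀ i → Fin (m i)) (i : Fin n) (σᵢ∉T : σ i ∉ T i) where

        mean≤estimatedMean : sum (λ v → S.P i (σ i) v * next t σ i v) ≤ sum (λ v → Ŝ.P i (σ i) v * next t σ i v) + spread * δ
        mean≤estimatedMean = sum-close (S.P i (σ i)) (Ŝ.P i (σ i)) (next t σ i)
          (trans (S.P-sum i (σ i)) (sym (Ŝ.P-sum i (σ i))))
          (λ A → abs[x-y]≤δ⇒y≤x+δ (Ŝ≈S.P-close i (σ i) σᵢ∉T A)) (0≤spread 0≤b)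
          (λ v → lowest≤planned t (σ [ i ≔ v ])) (λ v → planned≤lowest+spread 0≤b t (σ [ i ≔ v ]))

        estimatedMean≤mean : sum (λ v → Ŝ.P i (σ i) v * next t σ i v) ≤ sum (λ v → S.P i (σ i) v * next t σ i v) + spread * δ
        estimatedMean≤mean = sum-close (Ŝ.P i (σ i)) (S.P i (σ i)) (next t σ i)
          (trans (Ŝ.P-sum i (σ i)) (sym (S.P-sum i (σ i))))
          (λ A → abs[x-y]≤δ⇒x≤y+δ (Ŝ≈S.P-close i (σ i) σᵢ∉T A)) (0≤spread 0≤b)
          (λ v → lowest≤planned t (σ [ i ≔ v ])) (λ v → planned≤lowest+spread 0≤b t (σ [ i ≔ v ]))

      -- Induction on the strategy: each of its moves is also among the planner's options, with a
      -- credit computed from the estimates.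
      value≤planned : ∀ t {σ} → Budget Q S t σ → (τ : Strategy Q T σ) → value Q S τ ≤ plannedValue t σ + error t
      value≤planned t {σ} budget (select I I∈𝓕 ready) = begin
        sumOver I (λ i → S.r i (σ i)) + h I
          ≤⟨ +-monoˡ-≤ (h I) (sumOver-≤+ I 0≤δ (λ i i∈I → r≤clipped i (ready i i∈I))) ⟩
        sumOver I (clippedValues σ) + fromℕ n * δ + h I
          ≡⟨ solve 3 (λ x y z → x :+ y :+ z := x :+ z :+ y) refl (sumOver I (clippedValues σ)) (fromℕ n * δ) (h I) ⟩
        f I (clippedValues σ) + fromℕ n * δ
          ≤⟨ +-mono-≤ (select≤planned t σ I I∈𝓕 ready) (n*δ≤error t) ⟩
        plannedValue t σ + error t ∎
        where
        open ≤-Reasoning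
        -- Clipping loses nothing here, since the true values are at most b.
        r≤clipped : ∀ i → σ i ∈ T i → S.r i (σ i) ≤ clippedValues σ i + δ
        r≤clipped i σᵢ∈T = x-z≤y⇒x≤y+z (⊓-glb
          (x≤y+z⇒x-z≤y (abs[x-y]≤δ⇒y≤x+δ (Ŝ≈S.r-close i (σ i) σᵢ∈T)))
          (x≤y+z⇒x-z≤y (≤-trans (≤-trans (x≤abs[x] _) (proj₂ (bounded i) (σ i) σᵢ∈T)) (x≤x+y 0≤δ))))
      value≤planned zero    budget (advance i σᵢ∉T _) = contradiction σᵢ∉T (exhausted Q S budget i)
      value≤planned (suc t) {σ} budget (advance i σᵢ∉T τ) = x≤y+z⇒x-z≤y (≤-shift
        -- The four inequalities are the induction hypothesis, the change of transition
        -- probabilities, the change of price and the maximality of the plan. The solver checks that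
        -- their errors add up to `error (suc t)`.
        (+-mono-≤ (+-mono-≤ (+-mono-≤ ih (mean≤estimatedMean t σ i σᵢ∉T)) (abs[x-y]≤δ⇒x≤y+δ (Ŝ≈S.π-close i (σ i) σᵢ∉T)))
                  (x-z≤y⇒x≤y+z (advance≤planned t σ i σᵢ∉T)))
        (solve 10 (λ e y z π π̂ d u n t c →
            e :+ (y :+ (n :+ t :* (con 1 :+ c)) :* d :+ (z :+ c :* d) :+ (π :+ d) :+ (u :+ π̂))
            := u :+ (n :+ (con 1 :+ t) :* (con 1 :+ c)) :* d :+ π :+ (e :+ y :+ π̂ :+ z))
          refl (sum (λ v → S.P i (σ i) v * value Q S (τ v))) (sum (λ v → S.P i (σ i) v * next t σ i v))
          (sum (λ v → Ŝ.P i (σ i) v * next t σ i v)) (S.π i (σ i)) (Ŝ.π i (σ i)) δ (plannedValue (suc t) σ)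
          (fromℕ n) (fromℕ t) spread))
        where
        ih : sum (λ v → S.P i (σ i) v * value Q S (τ v)) ≤ sum (λ v → S.P i (σ i) v * next t σ i v) + error t
        ih = ≤-trans (sum-mean-mono (S.P-nonneg i (σ i)) (λ v 0<P → value≤planned t (spend Q S budget i σᵢ∉T v 0<P) (τ v)))
                     (≤-reflexive (sum-mean (S.P i (σ i)) (next t σ i) (error t) (S.P-sum i (σ i))))

      bestSet-value : ∀ {σ : ∀ i → Fin (m i)} → (∀ i → σ i ∈ T i) → h (bestSet Q) ≤ f (bestSet Q) (λ i → S.r i (σ i))
      bestSet-value {σ} ready = subst (h (bestSet Q) ≤_) (+-comm (h (bestSet Q)) (sumOver (bestSet Q) (λ i → S.r i (σ i))))
        (x≤x+y (sumOver-nonneg (bestSet Q) (λ i _ → nonneg i (σ i) (ready i))))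

      -- Each of at most t transitions costs at most b, and once all systems are ready, nonnegative
      -- values let `bestSet` earn at least its `h`.
      complete-value : ∀ t {σ} → Budget Q S t σ → h (bestSet Q) ≤ value Q S (complete t σ) + fromℕ t * b
      complete-value t {σ} budget with any? (λ i → ¬? (σ i ∈? T i))
      complete-value t {σ} budget | no all-ready = ≤-trans
        (bestSet-value {σ} (λ i → decidable-stable (σ i ∈? T i) (λ σᵢ∉T → all-ready (i , σᵢ∉T))))
        (x≤x+y (*-nonneg (fromℕ-nonneg t) 0≤b))
      complete-value zero budget | yes (i , σᵢ∉T) = contradiction σᵢ∉T (exhausted Q S budget i)
      complete-value (suc t) {σ} budget | yes (i , σᵢ∉T) = ≤-shift
        (+-mono-≤ (+-mono-≤ ih π≤b) (≤-reflexive (sym (x-y+y mean price))))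
        (solve 6 (λ H E w p b t →
            H :+ (E :+ t :* b :+ b :+ (w :+ p)) := w :+ (con 1 :+ t) :* b :+ (H :+ p :+ E))
          refl (h (bestSet Q)) mean (mean - price) price b (fromℕ t))
        where
        after : Fin (m i) → R
        after v = value Q S (complete t (σ [ i ≔ v ]))

        price mean : R
        price = S.π i (σ i)
        mean  = sum (λ v → S.P i (σ i) v * after v)

        π≤b : price ≤ b
        π≤b = ≤-trans (x≤abs[x] price) (proj₁ (bounded i) (σ i) σᵢ∉T)

        ih : h (bestSet Q) ≤ mean + fromℕ t * b
        ih = ≤-trans
          (≤mean (S.P-nonneg i (σ i)) (S.P-sum i (σ i)) (λ v 0<P → complete-value t (spend Q S budget i σᵢ∉T v 0<P)))
          (≤-reflexive (sum-mean (S.P i (σ i)) after (fromℕ t * b) (S.P-sum i (σ i))))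

      -- Induction on the horizon, checking every option that the planner may have chosen. The
      -- restriction `t ℕ.≤ N` ensures that the N prices deducted in `lowest` cover the t
      -- transitions left.
      planned≤value : ∀ t {σ} → t ℕ.≤ N → Budget Q S t σ → plannedValue t σ ≤ value Q S (plannedStrategy t σ) + error t
      planned≤value t {σ} t≤N budget = argmax-all proj₁ {P = λ o → proj₁ o ≤ value Q S (proj₂ o) + error t}
        lowest≤ (All-options select≤ t advance≤)
        where
        lowest≤ : lowest ≤ value Q S (complete t σ) + error t
        lowest≤ = ≤-trans
          (x≤y+z⇒x-z≤y (≤-trans (complete-value t budget) (+-monoʳ-≤ _ (*-monoʳ-≤ 0≤b (fromℕ-mono t≤N)))))
          (x≤x+y (0≤error t))

        select≤ : ∀ I → 𝓕 I → (∀ i → i ∈ I → σ i ∈ T i) →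
                  f I (clippedValues σ) ≤ f I (λ i → S.r i (σ i)) + error t
        select≤ I _ ready = begin
          sumOver I (clippedValues σ) + h I
            ≤⟨ +-monoˡ-≤ (h I) (sumOver-≤+ I 0≤δ (λ i i∈I →
                 ≤-trans (x⊓y≤x _ b) (abs[x-y]≤δ⇒x≤y+δ (Ŝ≈S.r-close i (σ i) (ready i i∈I))))) ⟩
          values + fromℕ n * δ + h I
            ≡⟨ solve 3 (λ x y z → x :+ y :+ z := x :+ z :+ y) refl values (fromℕ n * δ) (h I) ⟩
          values + h I + fromℕ n * δ
            ≤⟨ +-monoʳ-≤ _ (n*δ≤error t) ⟩
          values + h I + error t ∎
          where
          open ≤-Reasoning
          values = sumOver I (λ i → S.r i (σ i))

        advance≤ : ∀ t′ → t ≡ suc t′ → ∀ i σᵢ∉T → advanceValue (plan t′) σ i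
                   ≤ value Q S (advance {σ = σ} i σᵢ∉T (λ v → plannedStrategy t′ (σ [ i ≔ v ]))) + error t
        advance≤ t′ refl i σᵢ∉T = x≤y+z⇒x-z≤y (≤-shift
          (+-mono-≤ (+-mono-≤ (+-mono-≤ ih (estimatedMean≤mean t′ σ i σᵢ∉T)) (abs[x-y]≤δ⇒y≤x+δ (Ŝ≈S.π-close i (σ i) σᵢ∉T)))
                    (≤-reflexive (sym (x-y+y mean price))))
          (solve 10 (λ e y z π π̂ d w n t c →
              z :+ (e :+ (n :+ t :* (con 1 :+ c)) :* d :+ (y :+ c :* d) :+ (π̂ :+ d) :+ (w :+ π))
              := w :+ (n :+ (con 1 :+ t) :* (con 1 :+ c)) :* d :+ π̂ :+ (y :+ z :+ π :+ e))
            refl mean (sum (λ v → S.P i (σ i) v * next t′ σ i v)) (sum (λ v → Ŝ.P i (σ i) v * next t′ σ i v))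
            price (Ŝ.π i (σ i)) δ (mean - price) (fromℕ n) (fromℕ t′) spread))
          where
          after : Fin (m i) → R
          after v = value Q S (plannedStrategy t′ (σ [ i ≔ v ]))

          price mean : R
          price = S.π i (σ i)
          mean  = sum (λ v → S.P i (σ i) v * after v)

          ih : sum (λ v → S.P i (σ i) v * next t′ σ i v) ≤ mean + error t′
          ih = ≤-trans
            (sum-mean-mono (S.P-nonneg i (σ i)) (λ v 0<P →
              planned≤value t′ (ℕ.≤-trans (ℕ.n≤1+n t′) t≤N) (spend Q S budget i σᵢ∉T v 0<P)))
            (≤-reflexive (sum-mean (S.P i (σ i)) after (error t′) (S.P-sum i (σ i))))

  -- Totality of the frugal algorithm, and the comparison of α⁻¹ OPT with OPT.

  module _ {n k} (Q : Packing n k) (A : FrugalAlgorithm n) (y : Fin n → R) where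
    open Packing Q
    open FrugalAlgorithm A

    candidate? : ∀ M → Decidable (Candidate Q A y M)
    candidate? M i = ¬? (i ∈? M) ×-dec 𝓕? (M ∪ ⁅ i ⁆)

    -- Found in two passes: the largest marginal value first, then the least priority among the
    -- candidates attaining it.
    argMax-exists : ∀ M {i₀} → Candidate Q A y M i₀ → ∃ (IsArgMax Q A y M)
    argMax-exists M {i₀} i₀-candidate = j , proj₁ j-tied , j-max
      where
      gain : Fin n → R
      gain = marginal Q A y M

      candidates : List (Fin n)
      candidates = filter (candidate? M) (allFin n)

      top : Fin n
      top = argmax gain i₀ candidates

      Tied : Fin n → Set
      Tied i = Candidate Q A y M i × gain i ≡ gain top

      tied? : Decidable Tied
      tied? i = candidate? M i ×-dec (gain i ≟ᴿ gain top)

      ties : List (Fin n)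
      ties = filter tied? (allFin n)

      j : Fin n
      j = argmin priority top ties

      j-tied : Tied j
      j-tied = argmin-all priority
        (argmax-all gain i₀-candidate (All.all-filter (candidate? M) (allFin n)) , refl)
        (All.all-filter tied? (allFin n))

      j-max : ∀ i → Candidate Q A y M i → gain i < gain j ⊎ (gain i ≡ gain j × priority j ℕ.≤ priority i)
      j-max i i-candidate with gain i ≟ᴿ gain top
      ... | yes eq = inj₂ (trans eq (sym (proj₂ j-tied))
                          , All.lookup (f[argmin]≤f[xs] top ties) (∈-filter⁺ tied? (∈-allFin i) (i-candidate , eq)))
      ... | no neq = inj₁ (subst (gain i <_) (sym (proj₂ j-tied))
                            ( All.lookup (f[xs]≤f[argmax] i₀ candidates) (∈-filter⁺ (candidate? M) (∈-allFin i) i-candidate)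
                            , neq))

    -- The constructor `stop` quantifies over all maximizers; this lets a single one with
    -- nonpositive marginal value settle the others.
    argMax-dominates : ∀ M {j j′} → IsArgMax Q A y M j → IsArgMax Q A y M j′ → marginal Q A y M j′ ≤ marginal Q A y M j
    argMax-dominates M (_ , j-max) (j′-candidate , _) with j-max _ j′-candidate
    ... | inj₁ (le , _) = le
    ... | inj₂ (eq , _) = ≤-reflexive eq

    -- `IsApproximation` speaks only of sets that are returned, so a run has to be exhibited. It
    -- ends because M grows strictly inside a finite ground set.
    returns-exists : ∃ (Returns Q A y ∅)
    returns-exists = from ∅ (⊃-wellFounded ∅)
      where
      from : ∀ M → Acc _⊃_ M → ∃ (Returns Q A y M)
      from M (acc larger) with any? (candidate? M)
      ... | no none = M , stop (λ j j-max _ → none (j , proj₁ j-max))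
      ... | yes (_ , i₀-candidate) with argMax-exists M i₀-candidate
      ...   | j , j-max with marginal Q A y M j ≤? 0#
      ...     | yes ≤0 = M , stop (λ j′ j′-max 0< → <⇒≱ 0< (≤-trans (argMax-dominates M j-max j′-max) ≤0))
      ...     | no ≰0  with from (M ∪ ⁅ j ⁆) (larger (p⊆p∪q ⁅ j ⁆ , j , q⊆p∪q M ⁅ j ⁆ (x∈⁅x⁆ j) , proj₁ (proj₁ j-max)))
      ...       | I , returns = I , add j-max (≰⇒≥ ≰0 , λ eq → ≰0 (≤-reflexive (sym eq))) returns

  -- On sufficiently negative values only ∅ has nonnegative objective, and
  -- for α > 1 an α-approximation never returns a set of negative objective.
  h[∅]-nonneg : ∀ {n k} (Q : Packing n k) (A : FrugalAlgorithm n) {α} → 1# < α →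
                IsApproximation Q α A → 0# ≤ Packing.h Q ∅
  h[∅]-nonneg Q A {α} 1<α approximates = by-cases (nonempty? I)
    where
    open Packing Q
    H penalty : R
    H       = h (bestSet Q)
    -- Since H ≤ H² + 1, this makes H - penalty at most -1, so a single element of value -penalty
    -- outweighs anything gained from `h`.
    penalty = H * H + 1# + 1#

    y : Fin _ → R
    y _ = - penalty

    I : Subset _
    I = proj₁ (returns-exists Q A y)

    returns : Returns Q A y ∅ I
    returns = proj₂ (returns-exists Q A y)

    I∈𝓕 : 𝓕 I
    I∈𝓕 = proj₁ (approximates y I returns)

    0≤f : 0# ≤ f I y
    -- The guarantee is used with I compared to itself.
    0≤f = scaled≤⇒nonneg 1<α (proj₂ (approximates y I returns) I I∈𝓕)

    0≤penalty : 0# ≤ penalty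
    0≤penalty = +-nonneg (+-nonneg (0≤x*x H) 0≤1) 0≤1

    y≤0 : - penalty ≤ 0#
    y≤0 = subst₂ _≤_ (+-identityˡ _) (-‿inverseʳ penalty) (+-monoˡ-≤ (- penalty) 0≤penalty)

    by-cases : Dec (Nonempty I) → 0# ≤ h ∅
    by-cases (no empty) = subst (0# ≤_) (f[∅]≡h[∅] Q y)
      (subst (λ I → 0# ≤ f I y) (Empty-unique empty) 0≤f)
    by-cases (yes (i , i∈I)) = contradiction (≤-shift (+-mono-≤ 0≤H-penalty (x≤x*x+1 H))
      (begin
        1# + (- penalty + H + (H * H + 1#))   ≡⟨ solve 3 (λ -c H s → con 1 :+ (-c :+ H :+ s) := H :+ ((s :+ con 1) :+ -c)) refl (- penalty) H (H * H + 1#) ⟩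
        H + (penalty - penalty)               ≡⟨ cong (H +_) (-‿inverseʳ penalty) ⟩
        H + 0#                                ≡⟨ solve 1 (λ H → H :+ con 0 := con 0 :+ (con 0 :+ H)) refl H ⟩
        0# + (0# + H)                         ∎)) 1≰0
      where
      open ≡-Reasoning
      0≤H-penalty : 0# ≤ - penalty + H
      0≤H-penalty = ≤-trans 0≤f (+-mono-≤ (sumOver≤term i∈I (λ _ → y≤0)) (h≤h[bestSet] Q I∈𝓕))

  -- At α = 1 both sides agree whatever the sign of OPT. For α > 1, selecting nothing at once shows
  -- OPT to be nonnegative, and scaling by α⁻¹ ≤ 1 cannot increase it.
  α⁻¹*OPT≤OPT : ∀ {n k} (Q : Packing n k) {α} → 1# ≤ α → (A : FrugalAlgorithm n) → IsApproximation Q α A →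
                ∀ {m : Fin n → ℕ} {s : ∀ i → Fin (m i)} {T : ∀ i → Subset (m i)}
                (S : ∀ i → MarkovSystem (s i) (T i)) {OPT} → IsOPT Q S OPT → α ⁻¹ * OPT ≤ OPT
  α⁻¹*OPT≤OPT Q {α} 1≤α A approximates {s = s} S {OPT} (_ , optimal) with 1# ≟ᴿ α
  ... | yes refl = ≤-reflexive (trans (cong (_* OPT) (trans (sym (*-identityˡ _)) (*-inverseʳ (0≢1 ∘ sym)))) (*-identityˡ OPT))
  ... | no 1≢α   = subst (α ⁻¹ * OPT ≤_) (*-identityˡ OPT) (*-monoʳ-≤ 0≤OPT (1≤x⇒x⁻¹≤1 1≤α))
    where
    open Packing Q
    selectNothing = select ∅ (𝓕-∅ Q) (λ i i∈∅ → contradiction i∈∅ ∉⊥)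

    0≤OPT : 0# ≤ OPT
    0≤OPT = begin
      0#                                                ≤⟨ h[∅]-nonneg Q A (1≤α , 1≢α) approximates ⟩
      h ∅                                               ≡⟨ f[∅]≡h[∅] Q (λ i → MarkovSystem.r (S i) (s i)) ⟨
      f ∅ (λ i → MarkovSystem.r (S i) (s i))            ≡⟨ x-0 _ ⟨
      utility Q S selectNothing                         ≤⟨ optimal selectNothing ⟩
      OPT                                               ∎
      where open ≤-Reasoning

  -- The polynomial `q` and the final estimate.

  module _ (p : Polynomial) where

    -- β is positive and dominates p; E * δ is the planning error.
    β E q : Polynomial
    β = p ⊗ p ⊕ con 1#
    E = 𝐧 ⊕ (𝐧 ⊗ 𝐃) ⊗ (con 1# ⊕ (𝐧 ⊕ 𝐧 ⊗ 𝐃) ⊗ β)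
    q = con 1# ⊕ (E ⊕ E)

    0≤β : ∀ n k D → 0# ≤ ⟦ β ⟧ n k D
    0≤β n k D = +-nonneg (0≤x*x (⟦ p ⟧ n k D)) 0≤1

    0≤E : ∀ n k D → 0# ≤ ⟦ E ⟧ n k D
    0≤E n k D = +-nonneg 0≤n (*-nonneg 0≤nD (+-nonneg 0≤1 (*-nonneg (+-nonneg 0≤n 0≤nD) (0≤β n k D))))
      where
      0≤n  = fromℕ-nonneg n
      0≤nD = *-nonneg 0≤n (fromℕ-nonneg D)

    0<q : ∀ n k D → 0# < ⟦ q ⟧ n k D
    0<q n k D = 1≤x⇒0<x (x≤x+y (+-nonneg (0≤E n k D) (0≤E n k D)))

    module _ {n k} (Q : Packing n k) (D : ℕ) {m : Fin n → ℕ} {s : ∀ i → Fin (m i)} {T : ∀ i → Subset (m i)} where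

      private
        N = n ℕ.* D
        b = ⟦ β ⟧ n k D

      -- The horizon and the number of prices deducted in `lowest` are both n D, the budget
      -- available from s.
      robustStrategy : (∀ i → MarkovSystem (s i) (T i)) → Strategy Q T s
      robustStrategy Ŝ = Planning.plannedStrategy Q N b Ŝ N s

      robustStrategy-nearOptimal : ∀ {ε} → 0# < ε → (Ŝ S : ∀ i → MarkovSystem (s i) (T i)) →
        HasMaxDepth S D → (∀ i → NonNegativeValues (S i)) →
        ∀ {B} → (∀ i → BoundedBy (S i) B) → B ≤ ⟦ p ⟧ n k D →
        (∀ i → Close (ε * ⟦ q ⟧ n k D ⁻¹) (Ŝ i) (S i)) →
        ∀ τ → utility Q S τ ≤ utility Q S (robustStrategy Ŝ) + ε
      robustStrategy-nearOptimal {ε} 0<ε Ŝ S maxDepth nonneg {B} bounded B≤p close τ = begin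
        utility Q S τ                     ≡⟨ utility≡value Q S τ ⟩
        -- The planned value at s is compared with the true values of both strategies, losing
        -- `error N` each time; hence the two copies of `E` in `q`.
        value Q S τ                       ≤⟨ value≤planned N budget τ ⟩
        plannedValue N s + error N        ≤⟨ +-monoˡ-≤ (error N) (planned≤value N ℕ.≤-refl budget) ⟩
        achieved + error N + error N      ≡⟨ cong (λ e → achieved + e + e) error≡E*δ ⟩
        -- The summand 1 that makes `q` positive accounts for one further δ.
        achieved + ⟦E⟧ * δ + ⟦E⟧ * δ      ≤⟨ x≤x+y 0≤δ ⟩
        achieved + ⟦E⟧ * δ + ⟦E⟧ * δ + δ  ≡⟨ solve 3 (λ v E d → v :+ E :* d :+ E :* d :+ d := v :+ (con 1 :+ (E :+ E)) :* d)
                                                   refl achieved ⟦E⟧ δ ⟩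
        achieved + (1# + (⟦E⟧ + ⟦E⟧)) * δ ≡⟨ cong (achieved +_) q*δ≡ε ⟩
        achieved + ε                      ≡⟨ cong (_+ ε) (utility≡value Q S (robustStrategy Ŝ)) ⟨
        utility Q S (robustStrategy Ŝ) + ε ∎
        where
        open ≤-Reasoning
        ⟦E⟧ ⟦q⟧ δ achieved : R
        ⟦E⟧      = ⟦ E ⟧ n k D
        ⟦q⟧      = ⟦ q ⟧ n k D
        δ        = ε * ⟦q⟧ ⁻¹
        achieved = value Q S (robustStrategy Ŝ)

        B≤b : B ≤ b
        B≤b = ≤-trans B≤p (x≤x*x+1 (⟦ p ⟧ n k D))

        0≤δ : 0# ≤ δ
        0≤δ = *-nonneg (proj₁ 0<ε) (⁻¹-nonneg (0<q n k D))

        open Planning Q N b Ŝ using (plannedValue; module Robustness)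
        open Robustness S (0≤β n k D) 0≤δ close nonneg
          (λ i → (λ u u∉T → ≤-trans (proj₁ (bounded i) u u∉T) B≤b)
               , (λ t t∈T → ≤-trans (proj₂ (bounded i) t t∈T) B≤b))

        budget = initialBudget Q S maxDepth

        error≡E*δ : error N ≡ ⟦E⟧ * δ
        error≡E*δ = cong (λ N → (fromℕ n + N * (1# + (fromℕ n + N) * b)) * δ) (fromℕ-* n D)

        q*δ≡ε : ⟦q⟧ * δ ≡ ε
        q*δ≡ε = begin-equality
          ⟦q⟧ * (ε * ⟦q⟧ ⁻¹)   ≡⟨ solve 3 (λ q ε q⁻¹ → q :* (ε :* q⁻¹) := ε :* (q :* q⁻¹)) refl ⟦q⟧ ε (⟦q⟧ ⁻¹) ⟩
          ε * (⟦q⟧ * ⟦q⟧ ⁻¹)   ≡⟨ cong (ε *_) (*-inverseʳ (proj₂ (0<q n k D) ∘ sym)) ⟩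
          ε * 1#               ≡⟨ *-identityʳ ε ⟩
          ε                    ∎

theorem3 : (K : OrderedField) → let open MPOI K in
    (p : Polynomial) →
    Σ Polynomial λ q →
      (∀ n k D → 0# < ⟦ q ⟧ n k D) ×
      (∀ {n k} (Q : Packing n k) (D : ℕ) (α : R) → 1# ≤ α →
        (A : FrugalAlgorithm n) → IsApproximation Q α A →
        (m : Fin n → ℕ) (s : ∀ i → Fin (m i)) (T : ∀ i → Subset (m i)) →
        (ε : R) → 0# < ε →
        Σ ((∀ i → MarkovSystem (s i) (T i)) → Strategy Q T s) λ strategy →
          (Ŝ S : ∀ i → MarkovSystem (s i) (T i)) →
          (∀ i → IsDAG (S i)) →
          HasMaxDepth S D →
          (∀ i → NonNegativeValues (S i)) →
          (B : R) → (∀ i → BoundedBy (S i) B) → B ≤ ⟦ p ⟧ n k D →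
          (∀ i → Close (ε * (⟦ q ⟧ n k D) ⁻¹) (Ŝ i) (S i)) →
          (OPT : R) → IsOPT Q S OPT →
          α ⁻¹ * OPT - ε ≤ utility Q S (strategy Ŝ))
theorem3 K p = q K p , 0<q K p , λ Q D α 1≤α A approximates m s T ε 0<ε →
  robustStrategy K p Q D , λ Ŝ S _ maxDepth nonneg B bounded B≤p close OPT isOPT →
    x≤y+z⇒x-z≤y (≤-trans (α⁻¹*OPT≤OPT K Q 1≤α A approximates S isOPT)
      -- `IsOPT` provides a strategy attaining OPT, to which near-optimality is applied.
      (subst (λ z → z ≤ utility Q S (robustStrategy K p Q D Ŝ) + ε) (proj₂ (proj₁ isOPT))
        (robustStrategy-nearOptimal K p Q D 0<ε Ŝ S maxDepth nonneg bounded B≤p close (proj₁ (proj₁ isOPT)))))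
  where
  open MPOI K
  open OrderedFieldProperties K
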